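{- For every integer $n\geq 1$, the following equalities of combinatorial games hold: $$\uparrow^{[n]}*\ =\ \left\{0, \uparrow^{[n-1]}*\ \big|\ 0, \uparrow^{[n+1]}*\right\}\ =\ \left\{0, \uparrow^{[n-1]}*\ \big|\ 0\right\},$$ $$\downarrow_{[n]}*\ =\ \left\{0,\downarrow_{[n+1]}*\ \big|\ 0, \downarrow_{[n-1]}*\right\}\ =\ \left\{0\ \big|\ 0, \downarrow_{[n-1]}*\right\}.$$ Furthermore, $$\uparrow^{[n]}*\ =\ \left\{0,\{0,\uparrow^{[n]}*\ |\ 0,\uparrow^{[n]}*\}\ \Big|\ 0,\{0,\uparrow^{[n]}*\ |\ 0,\uparrow^{[n]}*\}\right\},$$ $$\downarrow_{[n]}*\ =\ \left\{0,\{0,\downarrow_{[n]}*\ |\ 0,\downarrow_{[n]}*\}\ \Big|\ 0,\{0,\downarrow_{[n]}*\ |\ 0,\downarrow_{[n]}*\}\right\}.$$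
   Context: Games are short partizan combinatorial games under normal play (the player unable to move loses), in Conway's theory: $\{X\mid Y\}$ denotes the game whose Left options are the games in $X$ and Right options the games in $Y$; $G+H$ is the disjunctive sum; $-G$ swaps the roles of Left and Right; $G=H$ means that $G+(-H)$ is a win for the second player. Notation: $0=\{\,\mid\,\}$, $*=\{0\mid 0\}$, $\uparrow=\{0\mid *\}$, $\downarrow=\{*\mid 0\}$; $\uparrow^{[1]}=\uparrow$ and $\uparrow^{[n]}=\{\uparrow^{[n-1]}\mid *\}$ for $n\geq 2$; $\downarrow_{[1]}=\downarrow$ and $\downarrow_{[n]}=\{*\mid \downarrow_{[n-1]}\}$ for $n\geq 2$; with the convention $\uparrow^{[0]}=\downarrow_{[0]}=0$. For a game $J$, $J*$ denotes $J+*$. -}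

module Defs where

open import Data.List using (List; []; _∷_; [_]; _++_)
open import Data.List.Membership.Propositional using (_∈_)
open import Data.Nat using (ℕ; zero; suc)
open import Data.Product using (_×_)

infix  4 _≈_
infixl 6 _+_
infix  8 -_

-- Short games.  The finite sets of options are represented by lists; the order
-- and multiplicity of options play no role in `WinsFirst` and `WinsSecond`.
data Game : Set where
  ⟨_∣_⟩ : (Ls Rs : List Game) → Game

data Player : Set where
  Left Right : Player

opponent : Player → Player
opponent Left  = Right
opponent Right = Left

options : Player → Game → List Game
options Left  ⟨ Ls ∣ Rs ⟩ = Ls
options Right ⟨ Ls ∣ Rs ⟩ = Rs

-- The helpers are `map -_`, `map (_+ H)` and `map (G +_)`, written out for the
-- termination checker.
mutual
  -_ : Game → Game
  - ⟨ Ls ∣ Rs ⟩ = ⟨ negAll Rs ∣ negAll Ls ⟩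

  negAll : List Game → List Game
  negAll []       = []
  negAll (G ∷ Gs) = - G ∷ negAll Gs

mutual
  _+_ : Game → Game → Game
  G@(⟨ GL ∣ GR ⟩) + H@(⟨ HL ∣ HR ⟩) =
    ⟨ addʳ GL H ++ addˡ G HL ∣ addʳ GR H ++ addˡ G HR ⟩

  addʳ : List Game → Game → List Game
  addʳ []       H = []
  addʳ (G ∷ Gs) H = (G + H) ∷ addʳ Gs H

  addˡ : Game → List Game → List Game
  addˡ G []       = []
  addˡ G (H ∷ Hs) = (G + H) ∷ addˡ G Hs

-- `WinsFirst p G` (`WinsSecond p G`): player p has a winning strategy in G under
-- normal play when p (the opponent of p) is to move.
mutual
  data WinsFirst (p : Player) (G : Game) : Set where
    move : ∀ {G′} → G′ ∈ options p G → WinsSecond p G′ → WinsFirst p G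

  data WinsSecond (p : Player) (G : Game) : Set where
    reply : (∀ {G′} → G′ ∈ options (opponent p) G → WinsFirst p G′) →
            WinsSecond p G

SecondPlayerWin : Game → Set
SecondPlayerWin G = WinsSecond Left G × WinsSecond Right G

_≈_ : Game → Game → Set
G ≈ H = SecondPlayerWin (G + (- H))

𝟎 : Game
𝟎 = ⟨ [] ∣ [] ⟩

⋆ : Game
⋆ = ⟨ [ 𝟎 ] ∣ [ 𝟎 ] ⟩

-- Since ↑[ 0 ] = ↓[ 0 ] = 𝟎, the recursive clauses give ↑[ 1 ] = ↑ = {0 | ⋆} and
-- ↓[ 1 ] = ↓ = {⋆ | 0}.
↑[_] : ℕ → Game
↑[ zero  ] = 𝟎
↑[ suc n ] = ⟨ [ ↑[ n ] ] ∣ [ ⋆ ] ⟩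

↓[_] : ℕ → Game
↓[ zero  ] = 𝟎
↓[ suc n ] = ⟨ [ ⋆ ] ∣ [ ↓[ n ] ] ⟩

↑⋆[_] : ℕ → Game
↑⋆[ n ] = ↑[ n ] + ⋆

↓⋆[_] : ℕ → Game
↓⋆[ n ] = ↓[ n ] + ⋆

{-# OPTIONS --safe #-}

-- G ≤ H is characterised by mutual induction on Left's options of G and Right's
-- options of H.  Each equality splits into two inequalities, which are checked
-- option by option; besides ⋆ + ⋆ = 0 they only need 0 ≤ ↑[ n ], ⋆ ≤ ↑⋆[ n ] and
-- the monotonicity of ↑⋆[ n ] in n.  The equalities for ↓ are the negatives of
-- those for ↑.
module Submission where

open import Data.List using ([]; _∷_; map; _++_)
open import Data.List.Membership.Propositional using (_∈_)
open import Data.List.Membership.Propositional.Properties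
  using (∈-map⁺; ∈-map⁻; ∈-++⁺ˡ; ∈-++⁺ʳ; ∈-++⁻)
open import Data.List.Relation.Unary.Any using (here; there)
open import Data.Nat using (ℕ; zero; suc; _∸_; _≤_; _≥_; z≤n; s≤s)
open import Data.Nat.Properties using (m≤n+m)
open import Data.Product using (_×_; _,_; ∃-syntax)
open import Data.Sum using (_⊎_; inj₁; inj₂)
open import Relation.Binary.PropositionalEquality
  using (_≡_; refl; sym; trans; cong; cong₂; subst; subst₂)
open import Defs

infix 4 _⊑_ _⧏_ _≃_

mutual
  -- `G ⊑ H` encodes that Left wins `H + - G` when Right starts, and `G ⧏ H` that Left wins it when
  -- Left starts. Both are given positively, so a proof is itself a strategy.
  data _⊑_ (G H : Game) : Set where
    ⊑-intro : (∀ {X} → X ∈ options Left G → X ⧏ H) →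
              (∀ {Y} → Y ∈ options Right H → G ⧏ Y) → G ⊑ H

  -- Classically G ⧏ H is the negation of H ⊑ G.
  data _⧏_ (G H : Game) : Set where
    viaLeft  : ∀ {Y} → Y ∈ options Left H → G ⊑ Y → G ⧏ H
    viaRight : ∀ {X} → X ∈ options Right G → X ⊑ H → G ⧏ H

-- Options of negatives and sums

negAll≡map : ∀ Gs → negAll Gs ≡ map -_ Gs
negAll≡map []       = refl
negAll≡map (G ∷ Gs) = cong (- G ∷_) (negAll≡map Gs)

addʳ≡map : ∀ Gs H → addʳ Gs H ≡ map (_+ H) Gs
addʳ≡map []       H = refl
addʳ≡map (G ∷ Gs) H = cong (G + H ∷_) (addʳ≡map Gs H)

addˡ≡map : ∀ G Hs → addˡ G Hs ≡ map (G +_) Hs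
addˡ≡map G []       = refl
addˡ≡map G (H ∷ Hs) = cong (G + H ∷_) (addˡ≡map G Hs)

options-neg : ∀ p G → options p (- G) ≡ map -_ (options (opponent p) G)
options-neg Left  ⟨ _ ∣ Rs ⟩ = negAll≡map Rs
options-neg Right ⟨ Ls ∣ _ ⟩ = negAll≡map Ls

options-+ : ∀ p G H →
  options p (G + H) ≡ map (_+ H) (options p G) ++ map (G +_) (options p H)
options-+ Left G@(⟨ GL ∣ _ ⟩) H@(⟨ HL ∣ _ ⟩) =
  cong₂ _++_ (addʳ≡map GL H) (addˡ≡map G HL)
options-+ Right G@(⟨ _ ∣ GR ⟩) H@(⟨ _ ∣ HR ⟩) =
  cong₂ _++_ (addʳ≡map GR H) (addˡ≡map G HR)

∈-options-neg⁺ : ∀ p G {X} → X ∈ options (opponent p) G → - X ∈ options p (- G)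
∈-options-neg⁺ p G m = subst (_ ∈_) (sym (options-neg p G)) (∈-map⁺ -_ m)

∈-options-neg⁻ : ∀ p G {Z} → Z ∈ options p (- G) →
  ∃[ X ] X ∈ options (opponent p) G × Z ≡ - X
∈-options-neg⁻ p G m = ∈-map⁻ -_ (subst (_ ∈_) (options-neg p G) m)

∈-options-+⁺ˡ : ∀ p G H {X} → X ∈ options p G → X + H ∈ options p (G + H)
∈-options-+⁺ˡ p G H m =
  subst (_ ∈_) (sym (options-+ p G H)) (∈-++⁺ˡ (∈-map⁺ (_+ H) m))

∈-options-+⁺ʳ : ∀ p G H {Y} → Y ∈ options p H → G + Y ∈ options p (G + H)
∈-options-+⁺ʳ p G H m =
  subst (_ ∈_) (sym (options-+ p G H)) (∈-++⁺ʳ _ (∈-map⁺ (G +_) m))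

∈-options-+⁻ : ∀ p G H {Z} → Z ∈ options p (G + H) →
  (∃[ X ] X ∈ options p G × Z ≡ X + H) ⊎ (∃[ Y ] Y ∈ options p H × Z ≡ G + Y)
∈-options-+⁻ p G H m
  with ∈-++⁻ (map (_+ H) (options p G)) (subst (_ ∈_) (options-+ p G H) m)
... | inj₁ m₁ = inj₁ (∈-map⁻ (_+ H) m₁)
... | inj₂ m₂ = inj₂ (∈-map⁻ (G +_) m₂)

negAll-++ : ∀ Gs Hs → negAll (Gs ++ Hs) ≡ negAll Gs ++ negAll Hs
negAll-++ []       Hs = refl
negAll-++ (G ∷ Gs) Hs = cong (- G ∷_) (negAll-++ Gs Hs)

mutual
  -- An equality of terms, not only of values: negation keeps the order inside the lists of options,
  -- so strategies can be carried across by `subst`.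
  neg-distrib-+ : ∀ G H → - (G + H) ≡ - G + - H
  neg-distrib-+ G@(⟨ GL ∣ GR ⟩) H@(⟨ HL ∣ HR ⟩) = cong₂ ⟨_∣_⟩
    (trans (negAll-++ (addʳ GR H) (addˡ G HR))
           (cong₂ _++_ (negAll-addʳ GR H) (negAll-addˡ G HR)))
    (trans (negAll-++ (addʳ GL H) (addˡ G HL))
           (cong₂ _++_ (negAll-addʳ GL H) (negAll-addˡ G HL)))

  negAll-addʳ : ∀ Gs H → negAll (addʳ Gs H) ≡ addʳ (negAll Gs) (- H)
  negAll-addʳ []       H = refl
  negAll-addʳ (G ∷ Gs) H = cong₂ _∷_ (neg-distrib-+ G H) (negAll-addʳ Gs H)

  negAll-addˡ : ∀ G Hs → negAll (addˡ G Hs) ≡ addˡ (- G) (negAll Hs)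
  negAll-addˡ G []       = refl
  negAll-addˡ G (H ∷ Hs) = cong₂ _∷_ (neg-distrib-+ G H) (negAll-addˡ G Hs)

-- From the order to winning strategies

mutual
  ⊑-neg : ∀ {G H} → G ⊑ H → - H ⊑ - G
  ⊑-neg {G} {H} (⊑-intro l r) = ⊑-intro left right
    where
    left : ∀ {X} → X ∈ options Left (- H) → X ⧏ - G
    left m with ∈-options-neg⁻ Left H m
    ... | _ , m′ , refl = ⧏-neg (r m′)
    right : ∀ {Y} → Y ∈ options Right (- G) → - H ⧏ Y
    right m with ∈-options-neg⁻ Right G m
    ... | _ , m′ , refl = ⧏-neg (l m′)

  ⧏-neg : ∀ {G H} → G ⧏ H → - H ⧏ - G
  ⧏-neg {H = H} (viaLeft m d)  = viaRight (∈-options-neg⁺ Right H m) (⊑-neg d)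
  ⧏-neg {G = G} (viaRight m d) = viaLeft (∈-options-neg⁺ Left G m) (⊑-neg d)

mutual
  ⊑⇒WinsSecond : ∀ {G H} → G ⊑ H → WinsSecond Left (H + - G)
  ⊑⇒WinsSecond {G} {H} (⊑-intro l r) = reply answer
    where
    answer : ∀ {Z} → Z ∈ options Right (H + - G) → WinsFirst Left Z
    answer m with ∈-options-+⁻ Right H (- G) m
    ... | inj₁ (_ , m′ , refl) = ⧏⇒WinsFirst (r m′)
    ... | inj₂ (_ , m′ , refl) with ∈-options-neg⁻ Right G m′
    ...   | _ , m″ , refl = ⧏⇒WinsFirst (l m″)

  ⧏⇒WinsFirst : ∀ {G H} → G ⧏ H → WinsFirst Left (H + - G)
  ⧏⇒WinsFirst {G} {H} (viaLeft m d) =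
    move (∈-options-+⁺ˡ Left H (- G) m) (⊑⇒WinsSecond d)
  ⧏⇒WinsFirst {G} {H} (viaRight m d) =
    move (∈-options-+⁺ʳ Left H (- G) (∈-options-neg⁺ Left G m)) (⊑⇒WinsSecond d)

mutual
  WinsSecond-neg : ∀ {G} → WinsSecond Left (- G) → WinsSecond Right G
  WinsSecond-neg {G} (reply f) =
    reply λ m → WinsFirst-neg (f (∈-options-neg⁺ Right G m))

  WinsFirst-neg : ∀ {G} → WinsFirst Left (- G) → WinsFirst Right G
  WinsFirst-neg {G} (move m w) with ∈-options-neg⁻ Left G m
  ... | _ , m′ , refl = move m′ (WinsSecond-neg w)

_≃_ : Game → Game → Set
G ≃ H = G ⊑ H × H ⊑ G

≃-neg : ∀ {G H} → G ≃ H → - G ≃ - H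
≃-neg (G⊑H , H⊑G) = ⊑-neg H⊑G , ⊑-neg G⊑H

-- Right's half comes from swapping roles: `- (G + - H)` is literally `- G + - - H`, which is the
-- game that `- H ⊑ - G` lets Left win moving second.
≃⇒≈ : ∀ {G H} → G ≃ H → G ≈ H
≃⇒≈ {G} {H} (G⊑H , H⊑G) =
  ⊑⇒WinsSecond H⊑G ,
  WinsSecond-neg (subst (WinsSecond Left) (sym (neg-distrib-+ G (- H)))
                        (⊑⇒WinsSecond (⊑-neg G⊑H)))

mutual
  ⊑-refl : ∀ G → G ⊑ G
  ⊑-refl G@(⟨ Ls ∣ Rs ⟩) =
    ⊑-intro (λ m → viaLeft m (∈⇒⊑-refl Ls m)) (λ m → viaRight m (∈⇒⊑-refl Rs m))

  ∈⇒⊑-refl : ∀ Gs {G} → G ∈ Gs → G ⊑ G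
  ∈⇒⊑-refl (G ∷ _)  (here refl) = ⊑-refl G
  ∈⇒⊑-refl (_ ∷ Gs) (there m)   = ∈⇒⊑-refl Gs m

-- Inequalities between 0, `⋆` and the games `↑⋆[ n ]`

⋆⧏𝟎 : ⋆ ⧏ 𝟎
⋆⧏𝟎 = viaRight (here refl) (⊑-refl 𝟎)

𝟎⧏⋆ : 𝟎 ⧏ ⋆
𝟎⧏⋆ = viaLeft (here refl) (⊑-refl 𝟎)

𝟎⊑⋆+⋆ : 𝟎 ⊑ ⋆ + ⋆
𝟎⊑⋆+⋆ = ⊑-intro (λ ()) λ { (here refl) → 𝟎⧏⋆ ; (there (here refl)) → 𝟎⧏⋆ }

⋆+⋆⊑𝟎 : ⋆ + ⋆ ⊑ 𝟎
⋆+⋆⊑𝟎 = ⊑-intro (λ { (here refl) → ⋆⧏𝟎 ; (there (here refl)) → ⋆⧏𝟎 }) (λ ())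

-- ↑[ n ] + 𝟎 is an option of ↑⋆[ n ] and is not syntactically ↑[ n ].
𝟎⊑↑+𝟎 : ∀ n → 𝟎 ⊑ ↑[ n ] + 𝟎
𝟎⊑↑+𝟎 zero    = ⊑-refl 𝟎
𝟎⊑↑+𝟎 (suc n) = ⊑-intro (λ ()) λ { (here refl) → 𝟎⧏⋆ }

⋆+⋆⊑↑+𝟎 : ∀ n → ⋆ + ⋆ ⊑ ↑[ n ] + 𝟎
⋆+⋆⊑↑+𝟎 zero    = ⋆+⋆⊑𝟎
⋆+⋆⊑↑+𝟎 (suc n) = ⊑-intro
  (λ { (here refl)         → viaRight (here refl) (𝟎⊑↑+𝟎 (suc n))
     ; (there (here refl)) → viaRight (here refl) (𝟎⊑↑+𝟎 (suc n)) })
  λ { (here refl) → viaLeft (here refl) ⋆+⋆⊑𝟎 }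

𝟎⧏↑⋆ : ∀ n → 𝟎 ⧏ ↑⋆[ n ]
𝟎⧏↑⋆ n = viaLeft (∈-options-+⁺ʳ Left ↑[ n ] ⋆ (here refl)) (𝟎⊑↑+𝟎 n)

↑⋆⧏𝟎 : ∀ n → ↑⋆[ n ] ⧏ 𝟎
↑⋆⧏𝟎 zero    = ⋆⧏𝟎
↑⋆⧏𝟎 (suc n) = viaRight (here refl) ⋆+⋆⊑𝟎

↑⋆⧏↑⋆-suc : ∀ n → ↑⋆[ n ] ⧏ ↑⋆[ suc n ]
↑⋆⧏↑⋆-suc n = viaLeft (here refl) (⊑-refl ↑⋆[ n ])

⋆⊑↑⋆ : ∀ n → ⋆ ⊑ ↑⋆[ n ]
⋆⊑↑⋆ zero    = ⊑-refl ⋆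
⋆⊑↑⋆ (suc n) = ⊑-intro
  (λ { (here refl) → 𝟎⧏↑⋆ (suc n) })
  λ { (here refl)         → viaRight (here refl) 𝟎⊑⋆+⋆
    ; (there (here refl)) → viaRight (here refl) (𝟎⊑↑+𝟎 (suc n)) }

-- Left's other option `↑[ suc n ] + 𝟎` reverses through `⋆`: Right replies to `⋆ + 𝟎`, which
-- computes to `⋆`. Hence the hypothesis `⋆ ⊑ G`.
↑⋆-suc-⊑ : ∀ n {G} → ↑⋆[ n ] ⧏ G → ⋆ ⊑ G →
  (∀ {Y} → Y ∈ options Right G → ↑⋆[ suc n ] ⧏ Y) → ↑⋆[ suc n ] ⊑ G
↑⋆-suc-⊑ n ↑⋆⧏G ⋆⊑G = ⊑-intro λ where
  (here refl)         → ↑⋆⧏G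
  (there (here refl)) → viaRight (here refl) ⋆⊑G

↑⋆-mono-≤ : ∀ {m n} → m ≤ n → ↑⋆[ m ] ⊑ ↑⋆[ n ]
↑⋆-mono-≤ {n = n} z≤n = ⋆⊑↑⋆ n
↑⋆-mono-≤ {suc m} {suc n} (s≤s m≤n) =
  ↑⋆-suc-⊑ m (viaLeft (here refl) (↑⋆-mono-≤ m≤n)) (⋆⊑↑⋆ (suc n)) λ where
    (here refl)         → viaRight (here refl) (⊑-refl (⋆ + ⋆))
    -- Right's move of `↑[ suc m ]` to `⋆` leaves `⋆ + ⋆`, which has value 0.
    (there (here refl)) → viaRight (here refl) (⋆+⋆⊑↑+𝟎 (suc n))

-- Right's options of `↑⋆[ suc n ]` are `⋆ + ⋆` and `↑[ suc n ] + 𝟎`. Both are at least 0, so a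
-- Right option 0 of `G` deals with them at once.
⊑-↑⋆-suc : ∀ n {G} → (∀ {X} → X ∈ options Left G → X ⧏ ↑⋆[ suc n ]) →
  𝟎 ∈ options Right G → G ⊑ ↑⋆[ suc n ]
⊑-↑⋆-suc n f 𝟎∈ = ⊑-intro f λ where
  (here refl)         → viaRight 𝟎∈ 𝟎⊑⋆+⋆
  (there (here refl)) → viaRight 𝟎∈ (𝟎⊑↑+𝟎 (suc n))

⋆⧏↑⋆-suc : ∀ n → ⋆ ⧏ ↑⋆[ suc n ]
⋆⧏↑⋆-suc n = viaLeft (here refl) (⋆⊑↑⋆ n)

⋆⊑⟨0,∣0,⟩ : ∀ {X Y} → ⋆ ⧏ Y → ⋆ ⊑ ⟨ 𝟎 ∷ X ∷ [] ∣ 𝟎 ∷ Y ∷ [] ⟩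
⋆⊑⟨0,∣0,⟩ ⋆⧏Y = ⊑-intro
  (λ { (here refl) → viaLeft (here refl) (⊑-refl 𝟎) })
  λ { (here refl) → ⋆⧏𝟎 ; (there (here refl)) → ⋆⧏Y }

double : Game → Game
double X = ⟨ 𝟎 ∷ X ∷ [] ∣ 𝟎 ∷ X ∷ [] ⟩

-- Needed for the nested form: there Left's option `↑⋆[ n ]` of `↑⋆[ suc n ]` is matched by
-- `double ↑⋆[ suc n ]`.
↑⋆⊑double : ∀ n → ↑⋆[ n ] ⊑ double ↑⋆[ suc n ]
↑⋆⊑double zero    = ⋆⊑⟨0,∣0,⟩ (⋆⧏↑⋆-suc 0)
↑⋆⊑double (suc n) =
  -- The option `↑⋆[ n ]` is compared with the Left option `↑⋆[ suc (suc n) ]` of the doubled game,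
  -- two indices higher.
  ↑⋆-suc-⊑ n (viaLeft (there (here refl)) (↑⋆-mono-≤ (m≤n+m n 2)))
             (⋆⊑⟨0,∣0,⟩ (⋆⧏↑⋆-suc (suc n))) λ where
    (here refl)         → ↑⋆⧏𝟎 (suc n)
    (there (here refl)) → ↑⋆⧏↑⋆-suc (suc n)

neg-↑ : ∀ n → - ↑[ n ] ≡ ↓[ n ]
neg-↑ zero    = refl
neg-↑ (suc n) = cong (λ X → ⟨ ⋆ ∷ [] ∣ X ∷ [] ⟩) (neg-↑ n)

neg-↑⋆ : ∀ n → - ↑⋆[ n ] ≡ ↓⋆[ n ]
neg-↑⋆ n = trans (neg-distrib-+ ↑[ n ] ⋆) (cong (_+ ⋆) (neg-↑ n))

module _ (n : ℕ) where
  private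
    G H H′ B : Game
    G  = ↑⋆[ suc n ]
    H  = ⟨ 𝟎 ∷ ↑⋆[ n ] ∷ [] ∣ 𝟎 ∷ ↑⋆[ suc (suc n) ] ∷ [] ⟩
    H′ = ⟨ 𝟎 ∷ ↑⋆[ n ] ∷ [] ∣ 𝟎 ∷ [] ⟩
    B  = double (double G)

    left-⧏G : ∀ {X} → X ∈ 𝟎 ∷ ↑⋆[ n ] ∷ [] → X ⧏ G
    left-⧏G (here refl)         = 𝟎⧏↑⋆ (suc n)
    left-⧏G (there (here refl)) = ↑⋆⧏↑⋆-suc n

    G⊑H : G ⊑ H
    G⊑H = ↑⋆-suc-⊑ n (viaLeft (there (here refl)) (⊑-refl ↑⋆[ n ]))
                     (⋆⊑⟨0,∣0,⟩ (⋆⧏↑⋆-suc (suc n))) λ where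
      (here refl)         → ↑⋆⧏𝟎 (suc n)
      (there (here refl)) → ↑⋆⧏↑⋆-suc (suc n)

    H⊑G : H ⊑ G
    H⊑G = ⊑-↑⋆-suc n left-⧏G (here refl)

    H⊑H′ : H ⊑ H′
    H⊑H′ = ⊑-intro (λ m → viaLeft m (⊑-refl _))
                   λ { (here refl) → viaRight (here refl) (⊑-refl 𝟎) }

    H′⊑H : H′ ⊑ H
    H′⊑H = ⊑-intro (λ m → viaLeft m (⊑-refl _)) λ where
      (here refl)         → viaRight (here refl) (⊑-refl 𝟎)
      -- The additional Right option `↑⋆[ suc (suc n) ]` is harmless: Left can move from it to `G`,
      -- and `H′ ⊑ G`.
      (there (here refl)) →
        viaLeft (here refl) (⊑-↑⋆-suc n left-⧏G (here refl))

    G⊑B : G ⊑ B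
    G⊑B = ↑⋆-suc-⊑ n (viaLeft (there (here refl)) (↑⋆⊑double n))
                     (⋆⊑⟨0,∣0,⟩ (viaLeft (there (here refl)) (⋆⊑↑⋆ (suc n)))) λ where
      (here refl)         → ↑⋆⧏𝟎 (suc n)
      -- `G` is an option of `double G` for both players, so either of them can return to `G`; Left
      -- does so here, and Right in `B⊑G`.
      (there (here refl)) → viaLeft (there (here refl)) (⊑-refl G)

    B⊑G : B ⊑ G
    B⊑G = ⊑-↑⋆-suc n
      (λ { (here refl)         → 𝟎⧏↑⋆ (suc n)
         ; (there (here refl)) → viaRight (there (here refl)) (⊑-refl G) })
      (here refl)

  ↑⋆-suc≃⟨0,↑⋆∣0,↑⋆⟩ : G ≃ H
  ↑⋆-suc≃⟨0,↑⋆∣0,↑⋆⟩ = G⊑H , H⊑G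

  ⟨0,↑⋆∣0,↑⋆⟩≃⟨0,↑⋆∣0⟩ : H ≃ H′
  ⟨0,↑⋆∣0,↑⋆⟩≃⟨0,↑⋆∣0⟩ = H⊑H′ , H′⊑H

  ↑⋆-suc≃nested : G ≃ B
  ↑⋆-suc≃nested = G⊑B , B⊑G

theorem2 : (n : ℕ) → n ≥ 1 →
    (↑⋆[ n ] ≈ ⟨ 𝟎 ∷ ↑⋆[ n ∸ 1 ] ∷ [] ∣ 𝟎 ∷ ↑⋆[ suc n ] ∷ [] ⟩)
    × (⟨ 𝟎 ∷ ↑⋆[ n ∸ 1 ] ∷ [] ∣ 𝟎 ∷ ↑⋆[ suc n ] ∷ [] ⟩ ≈ ⟨ 𝟎 ∷ ↑⋆[ n ∸ 1 ] ∷ [] ∣ 𝟎 ∷ [] ⟩)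
    × (↓⋆[ n ] ≈ ⟨ 𝟎 ∷ ↓⋆[ suc n ] ∷ [] ∣ 𝟎 ∷ ↓⋆[ n ∸ 1 ] ∷ [] ⟩)
    × (⟨ 𝟎 ∷ ↓⋆[ suc n ] ∷ [] ∣ 𝟎 ∷ ↓⋆[ n ∸ 1 ] ∷ [] ⟩ ≈ ⟨ 𝟎 ∷ [] ∣ 𝟎 ∷ ↓⋆[ n ∸ 1 ] ∷ [] ⟩)
    × (↑⋆[ n ] ≈ ⟨ 𝟎 ∷ ⟨ 𝟎 ∷ ↑⋆[ n ] ∷ [] ∣ 𝟎 ∷ ↑⋆[ n ] ∷ [] ⟩ ∷ [] ∣ 𝟎 ∷ ⟨ 𝟎 ∷ ↑⋆[ n ] ∷ [] ∣ 𝟎 ∷ ↑⋆[ n ] ∷ [] ⟩ ∷ [] ⟩)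
    × (↓⋆[ n ] ≈ ⟨ 𝟎 ∷ ⟨ 𝟎 ∷ ↓⋆[ n ] ∷ [] ∣ 𝟎 ∷ ↓⋆[ n ] ∷ [] ⟩ ∷ [] ∣ 𝟎 ∷ ⟨ 𝟎 ∷ ↓⋆[ n ] ∷ [] ∣ 𝟎 ∷ ↓⋆[ n ] ∷ [] ⟩ ∷ [] ⟩)
-- Matching on `suc n` lets `n ∸ 1` compute; the index passed to the module's results is one less
-- than the exponent.
theorem2 (suc n) _ =
    ≃⇒≈ G≃H
  , ≃⇒≈ H≃H′
  , subst₂ _≈_ (neg-↑⋆ (suc n)) neg-H (≃⇒≈ (≃-neg G≃H))
  , subst₂ _≈_ neg-H neg-H′ (≃⇒≈ (≃-neg H≃H′))
  , ≃⇒≈ G≃B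
  , subst₂ _≈_ (neg-↑⋆ (suc n)) neg-B (≃⇒≈ (≃-neg G≃B))
  where
  G≃H   = ↑⋆-suc≃⟨0,↑⋆∣0,↑⋆⟩ n
  H≃H′  = ⟨0,↑⋆∣0,↑⋆⟩≃⟨0,↑⋆∣0⟩ n
  G≃B   = ↑⋆-suc≃nested n
  -- Negation exchanges the two sides, so the larger index now stands on the left; 0 is its own
  -- negative by computation.
  neg-H = cong₂ (λ X Y → ⟨ 𝟎 ∷ X ∷ [] ∣ 𝟎 ∷ Y ∷ [] ⟩)
                (neg-↑⋆ (suc (suc n))) (neg-↑⋆ n)
  neg-H′ = cong (λ X → ⟨ 𝟎 ∷ [] ∣ 𝟎 ∷ X ∷ [] ⟩) (neg-↑⋆ n)
  neg-B = cong (λ X → double (double X)) (neg-↑⋆ (suc n))
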